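{- Let $m$ be a positive integer of the form $m=5\ell-1+c(6\ell-1)$ with $\ell$ a positive integer and $c\in\mathbb N$. Then $$\frac{4}{24m+1}=\frac{1}{6m+1}+\frac{1}{2\ell(6c+5)(24m+1)}+\frac{1}{2\ell(6c+5)(6\ell-1)(24m+1)},$$ and the corresponding triple $(n_1,n_2,n_3)=\bigl(6m+1,\;2\ell(6c+5)(24m+1),\;2\ell(6c+5)(6\ell-1)(24m+1)\bigr)$ is a wild solution of the Erdős–Straus equation for $24m+1$.
   Context: $\mathbb N$ denotes the set of nonnegative integers. For a positive integer $m$, the Erdős–Straus equation for $n=24m+1$ is $\frac{4}{n}=\frac1{n_1}+\frac1{n_2}+\frac1{n_3}$ in positive integers $n_1,n_2,n_3$. For $n_1=6m+k$ with $1\le k\le 12m$ one has $\frac{4}{24m+1}=\frac{1}{6m+k}+\frac{4k-1}{(6m+k)(24m+1)}$. A solution $(n_1,n_2,n_3)$ is called a wild solution if $n_1=6m+k$ for some integer $1\le k\le 12m$ and there exist an integer $L\ge 2$ (called a multiplier) and positive integers $J_1,J_2$ (called the numerator summands) such that $J_1+J_2=L(4k-1)$, $\gcd(L,J_1,J_2)=1$, $\frac1{n_2}=\frac{J_1}{L(6m+k)(24m+1)}$ and $\frac1{n_3}=\frac{J_2}{L(6m+k)(24m+1)}$. -}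

module Defs where

open import Data.Integer.Base using (+_)
open import Data.Nat.Base using (ℕ; _+_; _*_; _∸_; _≤_; s≤s; z≤n; NonZero; >-nonZero)
open import Data.Nat.GCD using (gcd)
open import Data.Nat.Properties using (m*n≢0; m≤n+m; ≤-trans)
import Data.Rational.Base as ℚ
open ℚ using (_/_)
open import Relation.Binary.PropositionalEquality.Core using (_≡_)

-- All four numbers are naturals, so NonZero says that they are positive.
record IsSolution (n n₁ n₂ n₃ : ℕ) : Set where
  field
    .{{n≢0}}  : NonZero n
    .{{n₁≢0}} : NonZero n₁
    .{{n₂≢0}} : NonZero n₂
    .{{n₃≢0}} : NonZero n₃
    equation  : + 4 / n ≡ (+ 1 / n₁) ℚ.+ (+ 1 / n₂) ℚ.+ (+ 1 / n₃)

denominator : (m k L : ℕ) → ℕ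
denominator m k L = L * (6 * m + k) * (24 * m + 1)

denominator≢0 : ∀ m k L → 1 ≤ k → 2 ≤ L → NonZero (denominator m k L)
denominator≢0 m k L 1≤k 2≤L =
  m*n≢0 (L * (6 * m + k)) (24 * m + 1)
    {{m*n≢0 L (6 * m + k) {{>-nonZero (≤-trans (s≤s z≤n) 2≤L)}}
                          {{>-nonZero (≤-trans 1≤k (m≤n+m k (6 * m)))}}}}
    {{>-nonZero (m≤n+m 1 (24 * m))}}

record IsWildSolution (m n₁ n₂ n₃ : ℕ) : Set where
  field
    isSolution : IsSolution (24 * m + 1) n₁ n₂ n₃

  open IsSolution isSolution public

  field
    k       : ℕ
    1≤k     : 1 ≤ k
    k≤12m   : k ≤ 12 * m
    n₁≡6m+k : n₁ ≡ 6 * m + k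

    multiplier   : ℕ
    2≤multiplier : 2 ≤ multiplier

    J₁ J₂   : ℕ
    1≤J₁    : 1 ≤ J₁
    1≤J₂    : 1 ≤ J₂
    -- The subtraction is not truncated, since 1 ≤ k.
    J₁+J₂   : J₁ + J₂ ≡ multiplier * (4 * k ∸ 1)
    coprime : gcd (gcd multiplier J₁) J₂ ≡ 1

  private instance
    D≢0 : NonZero (denominator m k multiplier)
    D≢0 = denominator≢0 m k multiplier 1≤k 2≤multiplier

  field
    1/n₂≡ : + 1 / n₂ ≡ + J₁ / denominator m k multiplier
    1/n₃≡ : + 1 / n₃ ≡ + J₂ / denominator m k multiplier

{-# OPTIONS --safe #-}

-- Put p = 6ℓ − 1, q = 6c + 5 and N = 24m + 1. The hypothesis on m says 6m + 1 = pq.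
-- The solution is wild with k = 1, L = 2ℓ, J₁ = p and J₂ = 1, since p + 1 = 3L and
-- p / (L pq N) = 1 / (L q N). Over the common denominator L pq N the right-hand side
-- has numerator L N + p + 1 = L (N + 3) = 4 L pq.
module Submission where

open import Defs
open import Data.Integer.Base as ℤ using (+_)
import Data.Integer.Properties as ℤ
open import Data.Nat.Base using (ℕ; suc; _+_; _*_; _∸_; s≤s; z≤n; NonZero; >-nonZero; >-nonZero⁻¹)
open import Data.Nat.Divisibility using (∣1⇒≡1)
open import Data.Nat.GCD using (gcd; gcd[m,n]∣n)
open import Data.Nat.Properties using (m*n≢0; m≤n+m; m≤m*n; m≤n*m; ≤-trans; +-assoc)
open import Data.Nat.Tactic.RingSolver using (solve-∀)
open import Data.Product.Base using (_×_; _,_)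
import Data.Rational.Base as ℚ
open ℚ using (_/_)
open import Data.Rational.Properties using (fromℚᵘ-cong; toℚᵘ-injective; toℚᵘ-homo-+; toℚᵘ-fromℚᵘ)
open import Data.Rational.Unnormalised.Base as ℚᵘ using (mkℚᵘ; *≡*)
import Data.Rational.Unnormalised.Properties as ℚᵘ
open import Relation.Binary.PropositionalEquality using (_≡_; refl; sym; trans; cong; cong₂; module ≡-Reasoning)

-- `_/_` is `fromℚᵘ` of an unnormalised fraction, and `fromℚᵘ` sends fractions with equal cross
-- products to the same reduced form.
/-cross : ∀ a b c d .{{_ : NonZero b}} .{{_ : NonZero d}} →
          a * d ≡ c * b → + a / b ≡ + c / d
/-cross a b@(suc b-1) c d@(suc d-1) eq =
  fromℚᵘ-cong {mkℚᵘ (+ a) b-1} {mkℚᵘ (+ c) d-1} (*≡* (begin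
    + a ℤ.* + d  ≡⟨ ℤ.pos-* a d ⟨
    + (a * d)    ≡⟨ cong +_ eq ⟩
    + (c * b)    ≡⟨ ℤ.pos-* c b ⟩
    + c ℤ.* + b  ∎))
  where open ≡-Reasoning

-- Addition in `ℚᵘ` puts the sum over `d * d`, so after passing to unnormalised fractions only one
-- factor `d` has to be cancelled.
+-/ : ∀ a b d .{{_ : NonZero d}} → (+ a / d) ℚ.+ (+ b / d) ≡ + (a + b) / d
+-/ a b d@(suc d-1) = toℚᵘ-injective (begin
  ℚ.toℚᵘ ((+ a / d) ℚ.+ (+ b / d))             ≈⟨ toℚᵘ-homo-+ (+ a / d) (+ b / d) ⟩
  ℚ.toℚᵘ (+ a / d) ℚᵘ.+ ℚ.toℚᵘ (+ b / d)       ≈⟨ ℚᵘ.+-cong (toℚᵘ-fromℚᵘ a/d) (toℚᵘ-fromℚᵘ b/d) ⟩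
  a/d ℚᵘ.+ b/d                                 ≈⟨ *≡* numerators ⟩
  mkℚᵘ (+ (a + b)) d-1                         ≈⟨ toℚᵘ-fromℚᵘ (mkℚᵘ (+ (a + b)) d-1) ⟨
  ℚ.toℚᵘ (+ (a + b) / d)                       ∎)
  where
  open ℚᵘ.≃-Reasoning
  a/d = mkℚᵘ (+ a) d-1
  b/d = mkℚᵘ (+ b) d-1

  numerators : (+ a ℤ.* + d ℤ.+ + b ℤ.* + d) ℤ.* + d ≡ + (a + b) ℤ.* + (d * d)
  numerators = trans (cong (ℤ._* + d) (sym (ℤ.*-distribʳ-+ (+ d) (+ a) (+ b))))
              (trans (ℤ.*-assoc (+ (a + b)) (+ d) (+ d))
                     (cong (+ (a + b) ℤ.*_) (sym (ℤ.pos-* d d))))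

-- Since 6(5ℓ - 1) + 1 = 5(6ℓ - 1), the left side is 5p + 6cp with p = 6ℓ - 1.
6m+1≡[6ℓ∸1]*[6c+5] : ∀ ℓ c .{{_ : NonZero ℓ}} →
  6 * ((5 * ℓ ∸ 1) + c * (6 * ℓ ∸ 1)) + 1 ≡ (6 * ℓ ∸ 1) * (6 * c + 5)
-- At `suc a` both truncated subtractions compute away, which leaves a semiring identity for the
-- solver.
6m+1≡[6ℓ∸1]*[6c+5] (suc a) c = identity a c
  where
  identity : ∀ a c → 6 * ((a + 4 * suc a) + c * (a + 5 * suc a)) + 1 ≡ (a + 5 * suc a) * (6 * c + 5)
  identity = solve-∀

6ℓ∸1+1≡2ℓ*3 : ∀ ℓ .{{_ : NonZero ℓ}} → (6 * ℓ ∸ 1) + 1 ≡ 2 * ℓ * 3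
6ℓ∸1+1≡2ℓ*3 (suc a) = identity a
  where
  identity : ∀ a → (a + 5 * suc a) + 1 ≡ 2 * suc a * 3
  identity = solve-∀

6ℓ∸1≢0 : ∀ ℓ .{{_ : NonZero ℓ}} → NonZero (6 * ℓ ∸ 1)
6ℓ∸1≢0 (suc a) = >-nonZero (≤-trans (s≤s z≤n) (m≤n+m (5 * suc a) a))

theorem3p1 : ∀ (m ℓ c : ℕ) .{{_ : NonZero m}} .{{_ : NonZero ℓ}} →
    m ≡ (5 * ℓ ∸ 1) + c * (6 * ℓ ∸ 1) →
    let n₁ = 6 * m + 1
        n₂ = 2 * ℓ * (6 * c + 5) * (24 * m + 1)
        n₃ = 2 * ℓ * (6 * c + 5) * (6 * ℓ ∸ 1) * (24 * m + 1)
    in IsSolution (24 * m + 1) n₁ n₂ n₃ × IsWildSolution m n₁ n₂ n₃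
theorem3p1 m ℓ c m≡ = solution , record
  { isSolution   = solution
  ; k            = 1
  ; 1≤k          = s≤s z≤n
  ; k≤12m        = ≤-trans (>-nonZero⁻¹ m) (m≤n*m m 12)
  ; n₁≡6m+k      = refl
  ; multiplier   = L
  ; 2≤multiplier = m≤m*n 2 ℓ
  ; J₁           = p
  ; J₂           = 1
  ; 1≤J₁         = >-nonZero⁻¹ p
  ; 1≤J₂         = s≤s z≤n
  -- For `k = 1` the factor `4 * k ∸ 1` computes to 3.
  ; J₁+J₂        = 6ℓ∸1+1≡2ℓ*3 ℓ
  -- The gcd divides `J₂ = 1`.
  ; coprime      = ∣1⇒≡1 (gcd[m,n]∣n (gcd L p) 1)
  ; 1/n₂≡        = 1/n₂≡p/D
  ; 1/n₃≡        = 1/n₃≡1/D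
  }
  where
  L = 2 * ℓ
  p = 6 * ℓ ∸ 1
  q = 6 * c + 5
  N = 24 * m + 1
  n₁ = 6 * m + 1
  n₂ = L * q * N
  n₃ = L * q * p * N
  D = denominator m 1 L

  n₁≡pq : n₁ ≡ p * q
  n₁≡pq = trans (cong (λ x → 6 * x + 1) m≡) (6m+1≡[6ℓ∸1]*[6c+5] ℓ c)

  -- These instances also fill the `NonZero` fields of `IsSolution`. As `_/_` takes its instance
  -- irrelevantly, fractions over `D` here agree with those in `IsWildSolution`.
  instance
    p≢0 : NonZero p
    p≢0 = 6ℓ∸1≢0 ℓ
    q≢0 : NonZero q
    q≢0 = >-nonZero (≤-trans (s≤s z≤n) (m≤n+m 5 (6 * c)))
    N≢0 : NonZero N
    N≢0 = >-nonZero (m≤n+m 1 (24 * m))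
    n₁≢0 : NonZero n₁
    n₁≢0 = >-nonZero (m≤n+m 1 (6 * m))
    L≢0 : NonZero L
    L≢0 = m*n≢0 2 ℓ
    Lq≢0 : NonZero (L * q)
    Lq≢0 = m*n≢0 L q
    Lqp≢0 : NonZero (L * q * p)
    Lqp≢0 = m*n≢0 (L * q) p
    n₂≢0 : NonZero n₂
    n₂≢0 = m*n≢0 (L * q) N
    n₃≢0 : NonZero n₃
    n₃≢0 = m*n≢0 (L * q * p) N
    D≢0 : NonZero D
    D≢0 = denominator≢0 m 1 L (s≤s z≤n) (m≤m*n 2 ℓ)

  1/n₁≡LN/D : + 1 / n₁ ≡ + (L * N) / D
  1/n₁≡LN/D = /-cross 1 n₁ (L * N) D (identity L n₁ N)
    where
    identity : ∀ L n N → 1 * (L * n * N) ≡ L * N * n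
    identity = solve-∀

  1/n₂≡p/D : + 1 / n₂ ≡ + p / D
  -- Replacing `n₁` by `p * q` inside `D` exhibits `D` as `p * n₂`.
  1/n₂≡p/D = /-cross 1 n₂ p D (trans (cong (λ x → 1 * (L * x * N)) n₁≡pq) (identity L p q N))
    where
    identity : ∀ L p q N → 1 * (L * (p * q) * N) ≡ p * (L * q * N)
    identity = solve-∀

  1/n₃≡1/D : + 1 / n₃ ≡ + 1 / D
  -- After the same replacement `D` is `n₃` with its factors reordered.
  1/n₃≡1/D = /-cross 1 n₃ 1 D (trans (cong (λ x → 1 * (L * x * N)) n₁≡pq) (identity L p q N))
    where
    identity : ∀ L p q N → 1 * (L * (p * q) * N) ≡ 1 * (L * q * p * N)
    identity = solve-∀

  4/N≡[LN+p+1]/D : + 4 / N ≡ + (L * N + p + 1) / D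
  4/N≡[LN+p+1]/D = /-cross 4 N (L * N + p + 1) D (begin
    -- `4 * n₁` is `N + 3`. The solver sees only `L` and `m`; the truncated `p` enters afterwards,
    -- through `p + 1` in place of `L * 3`.
    4 * (L * n₁ * N)               ≡⟨ identity L m ⟩
    (L * N + L * 3) * N            ≡⟨ cong (λ x → (L * N + x) * N) (6ℓ∸1+1≡2ℓ*3 ℓ) ⟨
    (L * N + (p + 1)) * N          ≡⟨ cong (_* N) (+-assoc (L * N) p 1) ⟨
    (L * N + p + 1) * N            ∎)
    where
    open ≡-Reasoning
    identity : ∀ L m → 4 * (L * (6 * m + 1) * (24 * m + 1)) ≡ (L * (24 * m + 1) + L * 3) * (24 * m + 1)
    identity = solve-∀

  solution : IsSolution N n₁ n₂ n₃
  solution = record { equation = begin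
    + 4 / N                                              ≡⟨ 4/N≡[LN+p+1]/D ⟩
    -- The numerator associates to the left like the sum of the three fractions, so `+-/` splits off
    -- one term at a time from the right.
    + (L * N + p + 1) / D                                ≡⟨ +-/ (L * N + p) 1 D ⟨
    (+ (L * N + p) / D) ℚ.+ (+ 1 / D)                    ≡⟨ cong (ℚ._+ (+ 1 / D)) (+-/ (L * N) p D) ⟨
    (+ (L * N) / D) ℚ.+ (+ p / D) ℚ.+ (+ 1 / D)          ≡⟨ cong₂ ℚ._+_ (cong₂ ℚ._+_ 1/n₁≡LN/D 1/n₂≡p/D) 1/n₃≡1/D ⟨
    (+ 1 / n₁) ℚ.+ (+ 1 / n₂) ℚ.+ (+ 1 / n₃)             ∎ }
    where open ≡-Reasoning
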